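{- Let $G$ be an Euler graph with at most two types of cycles (i.e. the lengths of all cycles of $G$ lie in at most two residue classes modulo $4$). Then $G$ is regular if and only if $G$ is an odd cycle graph or a regular bipartite Euler graph.
   Context: All graphs are finite, simple and connected. An Euler graph is a connected graph with at least one edge all of whose nodes have even degree. A cycle of length $n$ is of type $i$ if $n\equiv i\pmod 4$. An odd cycle graph is a graph consisting of a single cycle of odd length. -}

module Defs where

open import Data.Nat using (ℕ; zero; suc; _+_; _%_)
open import Data.Nat.DivMod using (_mod_)
open import Data.Nat.Divisibility using (_∣_)
open import Data.Bool using (Bool; true; false; if_then_else_)
open import Data.Fin using (Fin; toℕ)
open import Data.List using (List; map; allFin)
open import Data.Nat.ListAction using (sum)
open import Data.Product using (Σ; ∃; ∃-syntax; _×_; _,_)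
open import Data.Sum using (_⊎_)
open import Relation.Nullary using (¬_)
open import Relation.Binary.PropositionalEquality using (_≡_; _≢_)
open import Function.Definitions using (Injective; Surjective)

record Graph : Set where
  field
    n     : ℕ
    adj   : Fin n → Fin n → Bool
    sym   : ∀ u v → adj u v ≡ adj v u
    irrefl : ∀ v → adj v v ≡ false

module _ (G : Graph) where
  open Graph G

  Vertex : Set
  Vertex = Fin n

  Edge : Vertex → Vertex → Set
  Edge u v = adj u v ≡ true

  degree : Vertex → ℕ
  degree v = sum (map (λ w → if adj v w then 1 else 0) (allFin n))

  data Walk : Vertex → Vertex → Set where
    []  : ∀ {v} → Walk v v
    _∷_ : ∀ {u v w} → Edge u v → Walk v w → Walk u w

  Connected : Set
  Connected = ∀ u v → Walk u v

  IsEuler : Set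
  IsEuler = Connected × (∃[ u ] ∃[ v ] Edge u v) × (∀ v → 2 ∣ degree v)

  Regular : Set
  Regular = ∃[ d ] (∀ v → degree v ≡ d)

  Bipartite : Set
  Bipartite = Σ (Vertex → Bool) λ c → ∀ u v → Edge u v → c u ≢ c v

next : ∀ {k} → Fin (suc k) → Fin (suc k)
next {k} i = suc (toℕ i) mod suc k

record Cycle (G : Graph) (m : ℕ) : Set where
  field
    vtx    : Fin (3 + m) → Vertex G
    inj    : Injective _≡_ _≡_ vtx
    closed : ∀ i → Edge G (vtx i) (vtx (next i))

cycleLength : ∀ {G m} → Cycle G m → ℕ
cycleLength {m = m} _ = 3 + m

cycleType : ∀ {G m} → Cycle G m → ℕ
cycleType C = cycleLength C % 4

AtMostTwoCycleTypes : Graph → Set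
AtMostTwoCycleTypes G =
  ∃[ a ] ∃[ b ] (∀ m (C : Cycle G m) → cycleType C ≡ a ⊎ cycleType C ≡ b)

OddCycleGraph : Graph → Set
OddCycleGraph G =
  ∃[ m ] Σ (Cycle G m) λ C →
      ¬ (2 ∣ cycleLength C)
    × Surjective _≡_ _≡_ (Cycle.vtx C)
    × (∀ u v → Edge G u v →
         ∃[ i ] ((u ≡ Cycle.vtx C i × v ≡ Cycle.vtx C (next i))
               ⊎ (v ≡ Cycle.vtx C i × u ≡ Cycle.vtx C (next i))))

{-# OPTIONS --safe #-}
-- If G is not bipartite, an odd closed walk yields an odd cycle, and a connected 2-regular graph
-- consists of that cycle alone.  If the degree is at least 4, the two cycle types must be 0 and 2,
-- so there is no odd cycle.  Indeed, in a longest path u, v, … all neighbours v, y, b, c, … of u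
-- lie on the path.  Let x be the predecessor of y.  Unless x has a neighbour j beyond y, the
-- rotation x ⋯ u, y, … is again a longest path and its first chord is shorter, so after finitely
-- many rotations such a j exists.  The cycles formed by the chords uy, ub, uc force 2 to be one of
-- the types, and the chords uy, ub, xj make a subdivided K₄, whose seven cycle lengths cannot
-- all lie in {2, t} modulo 4 unless t = 0.

module Submission where

open import Defs
open import Data.Bool using (Bool; true; false; not; _xor_; if_then_else_)
import Data.Bool.Properties as Bool
open import Data.Fin using (Fin; zero; suc; toℕ; fromℕ; inject₁)
import Data.Fin.Properties as Fin
open import Data.List using (List; []; _∷_; _++_; [_]; length; reverse; lookup; filter; map; allFin)
open import Data.List.Membership.Propositional using (_∈_; _∉_; find)
open import Data.List.Membership.Propositional.Properties using (∈-++⁺ˡ; ∈-++⁺ʳ; ∈-++⁻; ∈-∃++; ∈-filter⁺; ∈-filter⁻; ∈-allFin; ∈-lookup)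
open import Data.List.Properties using (++-assoc; ++-identityʳ; length-++; length-reverse; length-tabulate; unfold-reverse)
open import Data.List.Relation.Binary.Disjoint.Propositional using (Disjoint)
open import Data.List.Relation.Binary.Permutation.Propositional using (_↭_; ↭-refl; ↭-sym; ↭-trans; prep; swap; ↭⇒↭ₛ)
open import Data.List.Relation.Binary.Permutation.Propositional.Properties using (∈-resp-↭; ↭-length; ↭-reverse; shift; ++-comm; shifts) renaming (++⁺ to ↭-++⁺; ++⁺ˡ to ↭-++⁺ˡ; ++⁺ʳ to ↭-++⁺ʳ)
import Data.List.Relation.Binary.Permutation.Setoid.Properties as SetoidPermutation
open import Data.List.Relation.Binary.Pointwise using (Pointwise; []; _∷_)
open import Data.List.Relation.Binary.Subset.Propositional using (_⊆_)
open import Data.List.Relation.Unary.All using (All; []; _∷_)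
import Data.List.Relation.Unary.All as All
import Data.List.Relation.Unary.All.Properties as All
open import Data.List.Relation.Unary.Any using (here; there)
import Data.List.Relation.Unary.Any as Any
open import Data.List.Relation.Unary.AllPairs using ([]; _∷_)
open import Data.List.Relation.Unary.Unique.Propositional using (Unique)
open import Data.List.Relation.Unary.Unique.Propositional.Properties using (allFin⁺; Unique[x∷xs]⇒x∉xs) renaming (++⁺ to Unique-++⁺; filter⁺ to Unique-filter⁺)
open import Data.Nat using (ℕ; zero; suc; _+_; _*_; _%_; _≤_; _<_; z≤n; s≤s; s≤s⁻¹)
open import Data.Nat.Divisibility using (_∣_; divides; _∣?_; ∣n∣m%n⇒∣m)
open import Data.Nat.DivMod using (_mod_; m<n⇒m%n≡m; n%n≡0; m%n%n≡m%n; %-distribˡ-+; m%n<n)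
open import Data.Nat.ListAction using (sum)
import Data.Nat.Properties as ℕ
open import Data.Product using (∃-syntax; _×_; _,_; proj₁; proj₂)
open import Data.Sum using (_⊎_; inj₁; inj₂)
import Data.Sum as Sum
open import Function using (_∘_; id)
open import Function.Bundles using (_⇔_; mk⇔)
open import Relation.Binary.PropositionalEquality using (_≡_; _≢_; refl; sym; trans; cong; cong₂; subst; subst₂; setoid)
open import Relation.Nullary using (¬_; Dec; yes; no; contradiction)
open import Relation.Nullary.Decidable using (_×-dec_; _⊎-dec_; _→-dec_; ¬?; decidable-stable; from-yes; from-no)
open import Relation.Unary using (Decidable)

-- Lists without repetitions.

private variable
  A : Set
  xs ys : List A

Unique-resp-↭ : xs ↭ ys → Unique xs → Unique ys
Unique-resp-↭ xs↭ys = SetoidPermutation.Unique-resp-↭ (setoid _) (↭⇒↭ₛ xs↭ys)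

Unique-++⁻ : ∀ (xs : List A) {ys} → Unique (xs ++ ys) → Unique xs × Unique ys × Disjoint xs ys
Unique-++⁻ [] uys = [] , uys , λ ()
Unique-++⁻ (x ∷ xs) (x≢ ∷ u) with Unique-++⁻ xs u
... | uxs , uys , xs#ys = All.++⁻ˡ xs x≢ ∷ uxs , uys , λ where
  (here refl , x∈ys) → All.lookup (All.++⁻ʳ xs x≢) x∈ys refl
  (there v∈xs , v∈ys) → xs#ys (v∈xs , v∈ys)

Unique-lookup-injective : Unique xs → ∀ {i j} → lookup xs i ≡ lookup xs j → i ≡ j
Unique-lookup-injective (x≢ ∷ u) {zero} {zero} _ = refl
Unique-lookup-injective (x≢ ∷ u) {zero} {suc j} eq = contradiction eq (All.lookup x≢ (∈-lookup j))
Unique-lookup-injective (x≢ ∷ u) {suc i} {zero} eq = contradiction (sym eq) (All.lookup x≢ (∈-lookup i))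
Unique-lookup-injective (x≢ ∷ u) {suc i} {suc j} eq = cong suc (Unique-lookup-injective u eq)

Unique-⊆⇒length-≤ : Unique xs → xs ⊆ ys → length xs ≤ length ys
Unique-⊆⇒length-≤ [] _ = z≤n
Unique-⊆⇒length-≤ {xs = x ∷ xs} (x≢ ∷ u) sub with ∈-∃++ (sub (here refl))
... | ys , zs , refl = subst (suc (length xs) ≤_) (sym (↭-length (shift x ys zs)))
  (s≤s (Unique-⊆⇒length-≤ u λ v∈xs → delete v∈xs (∈-resp-↭ (shift x ys zs) (sub (there v∈xs)))))
  where
  delete : ∀ {v} → v ∈ xs → v ∈ x ∷ ys ++ zs → v ∈ ys ++ zs
  delete v∈xs (here refl) = contradiction refl (All.lookup x≢ v∈xs)
  delete _ (there v∈) = v∈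

-- Finds the next neighbour of a vertex along a path; the count `k` that remains lets the search be
-- repeated on `zs`.
filter-first : {P : A → Set} (P? : Decidable P) (xs : List A) → ∀ {k} → suc k ≤ length (filter P? xs) →
  ∃[ ys ] ∃[ z ] ∃[ zs ] (xs ≡ ys ++ z ∷ zs × P z × All (¬_ ∘ P) ys × k ≤ length (filter P? zs))
filter-first P? (x ∷ xs) k< with P? x
... | yes px = [] , x , xs , refl , px , [] , s≤s⁻¹ k<
... | no ¬px with filter-first P? xs k<
...   | ys , z , zs , refl , pz , ¬pys , k≤ = x ∷ ys , z , zs , refl , pz , ¬px ∷ ¬pys , k≤

duplicate? : ∀ {m} (L : List (Fin m)) →
  Unique L ⊎ ∃[ A ] ∃[ z ] ∃[ B ] ∃[ C ] L ≡ A ++ z ∷ B ++ z ∷ C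
duplicate? [] = inj₁ []
duplicate? (v ∷ L) with Any.any? (v Fin.≟_) L | duplicate? L
... | yes v∈L | _ with ∈-∃++ v∈L
...   | B , C , refl = inj₂ ([] , v , B , C , refl)
duplicate? (v ∷ L) | no v∉L | inj₁ uL = inj₁ (All.¬Any⇒All¬ L v∉L ∷ uL)
duplicate? (v ∷ L) | no _ | inj₂ (A , z , B , C , refl) = inj₂ (v ∷ A , z , B , C , refl)

-- A repeated vertex z splits a closed trail into two closed trails with these lengths; as they add
-- up, one of them is odd when the whole is.
length-excise : ∀ {V : Set} (A : List V) z B C →
  length (A ++ z ∷ B ++ z ∷ C) ≡ length (z ∷ B) + length (A ++ z ∷ C)
length-excise A z B C = trans (↭-length (shifts A (z ∷ B))) (length-++ (z ∷ B))

-- Parity, and the cyclic successor `next`.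

odd : ℕ → Bool
odd zero = false
odd (suc n) = not (odd n)

odd-+ : ∀ m n → odd (m + n) ≡ odd m xor odd n
odd-+ zero n = refl
odd-+ (suc m) n rewrite odd-+ m n = Bool.not-distribˡ-xor (odd m) (odd n)

odd⇒¬2∣ : ∀ {n} → odd n ≡ true → ¬ 2 ∣ n
odd⇒¬2∣ eq (divides q refl) = contradiction (trans (sym eq) (even-double q)) λ ()
  where
  even-double : ∀ q → odd (q * 2) ≡ false
  even-double zero = refl
  even-double (suc q) rewrite even-double q = refl

toℕ-next-< : ∀ {k} (i : Fin (suc k)) → suc (toℕ i) < suc k → toℕ (next i) ≡ suc (toℕ i)
toℕ-next-< {k} i i<k = trans (Fin.toℕ-fromℕ< (m%n<n (suc (toℕ i)) (suc k))) (m<n⇒m%n≡m i<k)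

toℕ-next-last : ∀ {k} (i : Fin (suc k)) → suc (toℕ i) ≡ suc k → toℕ (next i) ≡ 0
toℕ-next-last {k} i i≡k = trans (Fin.toℕ-fromℕ< (m%n<n (suc (toℕ i)) (suc k)))
  (trans (cong (_% suc k) i≡k) (n%n≡0 (suc k)))

next-cases : ∀ {k} (i : Fin (suc k)) →
  (toℕ (next i) ≡ suc (toℕ i)) ⊎ (toℕ (next i) ≡ 0 × suc (toℕ i) ≡ suc k)
next-cases i with ℕ.m≤n⇒m<n∨m≡n (Fin.toℕ<n i)
... | inj₁ i<k = inj₁ (toℕ-next-< i i<k)
... | inj₂ i≡k = inj₂ (toℕ-next-last i i≡k , i≡k)

next-surjective : ∀ {k} (i : Fin (suc k)) → ∃[ j ] next j ≡ i
next-surjective {k} zero = fromℕ k , Fin.toℕ-injective (toℕ-next-last (fromℕ k) (cong suc (Fin.toℕ-fromℕ k)))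
next-surjective {suc k} (suc i) = inject₁ i , Fin.toℕ-injective
  (trans (toℕ-next-< (inject₁ i) (subst (λ t → suc t < suc (suc k)) (sym (Fin.toℕ-inject₁ i)) (s≤s (Fin.toℕ<n i))))
         (cong suc (Fin.toℕ-inject₁ i)))

next-injective : ∀ {k} {i j : Fin (suc k)} → next i ≡ next j → i ≡ j
next-injective {i = i} {j} eq with next-cases i | next-cases j
... | inj₁ p | inj₁ q = Fin.toℕ-injective (ℕ.suc-injective (trans (sym p) (trans (cong toℕ eq) q)))
... | inj₁ p | inj₂ (q , _) = contradiction (trans (sym p) (trans (cong toℕ eq) q)) λ ()
... | inj₂ (p , _) | inj₁ q = contradiction (trans (sym q) (trans (cong toℕ (sym eq)) p)) λ ()
... | inj₂ (_ , p) | inj₂ (_ , q) = Fin.toℕ-injective (ℕ.suc-injective (trans p (sym q)))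

-- Returning to i after wrapping around would force a length of at most 2. Hence successor and
-- predecessor on a cycle differ.
next²-≢ : ∀ {k} (i : Fin (3 + k)) → next (next i) ≢ i
next²-≢ i eq with next-cases i | next-cases (next i)
... | inj₁ p | inj₁ q = ℕ.m≢1+n+m (toℕ i) {1} (trans (cong toℕ (sym eq)) (trans q (cong suc p)))
... | inj₁ p | inj₂ (q , r) with trans (sym r) (cong suc (trans p (cong suc (trans (cong toℕ (sym eq)) q))))
...   | ()
next²-≢ i eq | inj₂ (p , r) | inj₁ q with trans (sym r) (cong suc (trans (cong toℕ (sym eq)) (trans q (cong suc p))))
... | ()
next²-≢ i eq | inj₂ (p , r) | inj₂ (q , _) with trans (sym r) (cong suc (trans (cong toℕ (sym eq)) q))
... | ()

-- Cycle lengths modulo 4.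

-- Orders of cycles in the two extensions of a `Frame` (below) whose paths have p, q, r vertices.
fanLengths K₄Lengths : ℕ → ℕ → ℕ → List ℕ
fanLengths p q r = p + 1 ∷ p + (q + 1) ∷ 1 + (q + 1) ∷ p + (q + r) ∷ 1 + (q + r) ∷ 1 + r ∷ []
K₄Lengths p q r = p + 1 ∷ p + (q + 1) ∷ 1 + (q + 1) ∷ p + (q + r) ∷ 1 + (q + r) ∷ p + r ∷ 3 + r ∷ []

OfType : Fin 4 → Fin 4 → ℕ → Set
OfType a b ℓ = ℓ % 4 ≡ toℕ a ⊎ ℓ % 4 ≡ toℕ b

OfType? : ∀ a b → Decidable (OfType a b)
OfType? a b ℓ = (ℓ % 4 ℕ.≟ toℕ a) ⊎-dec (ℓ % 4 ℕ.≟ toℕ b)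

-- Checked on all residues. Conceptually, the lengths minus 2 are the differences of four partial
-- sums 0, s₁, s₂, s₃ with steps p - 1, q, r - 1. If no difference were 0 modulo 4, then s₁, s₂, s₃
-- would be three distinct residues, one too many.
fan-residues : ∀ a b p q r → All (OfType a b) (fanLengths (toℕ p) (toℕ q) (toℕ r)) → OfType a b 2
fan-residues = from-yes (Fin.all? {4} λ a → Fin.all? {4} λ b → Fin.all? {4} λ p → Fin.all? {4} λ q → Fin.all? {4} λ r →
  All.all? (OfType? a b) (fanLengths (toℕ p) (toℕ q) (toℕ r)) →-dec OfType? a b 2)

-- Checked on all residues. Conceptually, put k = p - 1, l = q, m = r - 1. The lengths minus 2 are
-- k, k + l, l, k + l + m, l + m, k + m, m + 2. If they lay in {0, s} with s odd, then l, l + m and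
-- m + 2 would force l = s and m = -s, likewise k = s, and k + l = 2 would be excluded.
K₄-residues : ∀ a b p q r → All (OfType a b) (K₄Lengths (toℕ p) (toℕ q) (toℕ r)) → OfType a b 2 →
  2 ∣ toℕ a × 2 ∣ toℕ b
K₄-residues = from-yes (Fin.all? {4} λ a → Fin.all? {4} λ b → Fin.all? {4} λ p → Fin.all? {4} λ q → Fin.all? {4} λ r →
  All.all? (OfType? a b) (K₄Lengths (toℕ p) (toℕ q) (toℕ r)) →-dec OfType? a b 2 →-dec (2 ∣? toℕ a) ×-dec (2 ∣? toℕ b))

_≈₄_ : ℕ → ℕ → Set
m ≈₄ n = m % 4 ≡ n % 4

-- The summands are explicit because they cannot be recovered from their residues.
+-cong₄ : ∀ k l m n → k ≈₄ l → m ≈₄ n → (k + m) ≈₄ (l + n)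
+-cong₄ k l m n k≈l m≈n = trans (%-distribˡ-+ k m 4)
  (trans (cong₂ (λ s t → (s + t) % 4) k≈l m≈n) (sym (%-distribˡ-+ l n 4)))

mod-≈₄ : ∀ m → m ≈₄ toℕ (m mod 4)
mod-≈₄ m = sym (trans (cong (_% 4) (Fin.toℕ-fromℕ< (m%n<n m 4))) (m%n%n≡m%n m 4))

module _ {a b : Fin 4} where

  OfType-resp-≈₄ : ∀ m n → m ≈₄ n → OfType a b m → OfType a b n
  OfType-resp-≈₄ m n m≈n = Sum.map (trans (sym m≈n)) (trans (sym m≈n))

  All-OfType-resp-≈₄ : ∀ {ks ls} → Pointwise _≈₄_ ks ls → All (OfType a b) ks → All (OfType a b) ls
  All-OfType-resp-≈₄ [] [] = []
  All-OfType-resp-≈₄ {k ∷ _} {l ∷ _} (k≈l ∷ ks≈ls) (t ∷ ts) = OfType-resp-≈₄ k l k≈l t ∷ All-OfType-resp-≈₄ ks≈ls ts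

  -- The two configurations may have unrelated path lengths: the fan only contributes that 2 is a
  -- type.
  fan×K₄⇒even : ∀ {p q r p′ q′ r′} → All (OfType a b) (fanLengths p q r) → All (OfType a b) (K₄Lengths p′ q′ r′) →
    2 ∣ toℕ a × 2 ∣ toℕ b
  fan×K₄⇒even {p} {q} {r} {p′} {q′} {r′} fan K₄ =
    K₄-residues a b (p′ mod 4) (q′ mod 4) (r′ mod 4) (All-OfType-resp-≈₄ (K₄-mod p′ q′ r′) K₄)
      (fan-residues a b (p mod 4) (q mod 4) (r mod 4) (All-OfType-resp-≈₄ (fan-mod p q r) fan))
    where
    reduce : ℕ → ℕ
    reduce m = toℕ (m mod 4)
    _⊕_ : ∀ m n → (m + n) ≈₄ (reduce m + reduce n)
    m ⊕ n = +-cong₄ m (reduce m) n (reduce n) (mod-≈₄ m) (mod-≈₄ n)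
    sum₃ : ∀ k m n → (k + (m + n)) ≈₄ (reduce k + (reduce m + reduce n))
    sum₃ k m n = +-cong₄ k (reduce k) (m + n) (reduce m + reduce n) (mod-≈₄ k) (m ⊕ n)
    fan-mod : ∀ p q r → Pointwise _≈₄_ (fanLengths p q r) (fanLengths (reduce p) (reduce q) (reduce r))
    fan-mod p q r = p ⊕ 1 ∷ sum₃ p q 1 ∷ sum₃ 1 q 1 ∷ sum₃ p q r ∷ sum₃ 1 q r ∷ 1 ⊕ r ∷ []
    K₄-mod : ∀ p q r → Pointwise _≈₄_ (K₄Lengths p q r) (K₄Lengths (reduce p) (reduce q) (reduce r))
    K₄-mod p q r = p ⊕ 1 ∷ sum₃ p q 1 ∷ sum₃ 1 q 1 ∷ sum₃ p q r ∷ sum₃ 1 q r ∷ p ⊕ r ∷ 3 ⊕ r ∷ []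

-- Neighbours and degrees.

module GraphTheory (G : Graph) where
  open Graph G using (n; adj; irrefl) renaming (sym to adj-sym)

  private
    V : Set
    V = Vertex G

    E : V → V → Set
    E = Edge G

    variable
      u v w x z : V
      L M : List V

  E-sym : E u v → E v u
  E-sym {u} {v} uv = trans (adj-sym v u) uv

  E-irrefl : ¬ E v v
  E-irrefl {v} vv = contradiction (trans (sym (irrefl v)) vv) λ ()

  E? : ∀ u v → Dec (E u v)
  E? u v = adj u v Bool.≟ true

  neighbours : V → List V
  neighbours v = filter (E? v) (allFin n)

  degree≡length : ∀ v → degree G v ≡ length (neighbours v)
  degree≡length v = go (allFin n)
    where
    go : ∀ L → sum (map (λ w → if adj v w then 1 else 0) L) ≡ length (filter (E? v) L)
    go [] = refl
    go (w ∷ L) with adj v w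
    ... | true = cong suc (go L)
    ... | false = go L

  ∈-neighbours⁺ : E v w → w ∈ neighbours v
  ∈-neighbours⁺ {v} {w} = ∈-filter⁺ (E? v) (∈-allFin w)

  ∈-neighbours⁻ : w ∈ neighbours v → E v w
  ∈-neighbours⁻ {v = v} = proj₂ ∘ ∈-filter⁻ (E? v) {xs = allFin n}

  degree-≤ : (∀ {w} → E v w → w ∈ L) → degree G v ≤ length L
  degree-≤ {v} sub = subst (_≤ _) (sym (degree≡length v))
    (Unique-⊆⇒length-≤ (Unique-filter⁺ (E? v) (allFin⁺ n)) (sub ∘ ∈-neighbours⁻))

  degree-≥ : Unique L → All (E v) L → length L ≤ degree G v
  degree-≥ {v = v} uL all = subst (_ ≤_) (sym (degree≡length v))
    (Unique-⊆⇒length-≤ uL (∈-neighbours⁺ ∘ All.lookup all))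

  Unique⇒length≤n : Unique L → length L ≤ n
  Unique⇒length≤n {L} uL = subst (length L ≤_) (length-tabulate {n = n} id) (Unique-⊆⇒length-≤ uL λ {v} _ → ∈-allFin v)

  -- Trails and paths.

  -- A walk indexed by its list of vertices. Vertices and edges may repeat; a path is a trail whose
  -- list is `Unique`.
  data Trail : V → List V → V → Set where
    single : ∀ v → Trail v [ v ] v
    cons   : E u v → Trail v L w → Trail u (u ∷ L) w

  Trail-join : Trail u L v → E v w → Trail w M z → Trail u (L ++ M) z
  Trail-join (single v) e s = cons e s
  Trail-join (cons e′ t) e s = cons e′ (Trail-join t e s)

  Trail-reverse : Trail u L v → Trail v (reverse L) u
  Trail-reverse (single v) = single v
  Trail-reverse (cons {u = u} {L = L} e t) =
    subst (λ K → Trail _ K u) (sym (unfold-reverse u L)) (Trail-join (Trail-reverse t) (E-sym e) (single u))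

  Trail-head : Trail u (v ∷ L) w → u ≡ v
  Trail-head (single _) = refl
  Trail-head (cons _ _) = refl

  Trail-start∈ : Trail u L v → u ∈ L
  Trail-start∈ (single _) = here refl
  Trail-start∈ (cons _ _) = here refl

  Trail-end∈ : Trail u L v → v ∈ L
  Trail-end∈ (single _) = here refl
  Trail-end∈ (cons _ t) = there (Trail-end∈ t)

  Trail-split : ∀ L {y} → Trail u (x ∷ L ++ y ∷ M) w →
    ∃[ v ] (Trail u (x ∷ L) v × E v y × Trail y (y ∷ M) w)
  Trail-split [] (cons e t) with Trail-head t
  ... | refl = _ , single _ , e , t
  Trail-split (_ ∷ L) (cons e t) with Trail-split L t
  ... | v , t₁ , e′ , t₂ = v , cons e t₁ , e′ , t₂

  Trail-prefix : Trail u L w → z ∈ L → ∃[ K ] ∃[ M ] (L ≡ K ++ M × Trail u K z)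
  Trail-prefix (single v) (here refl) = _ , _ , refl , single v
  Trail-prefix (cons {u = u} {L = L} e t) (here refl) = [ u ] , L , refl , single u
  Trail-prefix (cons e t) (there z∈) with Trail-prefix t z∈
  ... | K , M , refl , s = _ ∷ K , M , refl , cons e s

  Trail-lookup-step : Trail u L v → ∀ {i j} → toℕ j ≡ suc (toℕ i) → E (lookup L i) (lookup L j)
  Trail-lookup-step (single _) {zero} {zero} ()
  Trail-lookup-step (cons e t) {zero} {suc j} eq = subst (E _) (sym (lookup-0 t (ℕ.suc-injective eq))) e
    where
    lookup-0 : Trail u L v → ∀ {i} → toℕ i ≡ 0 → lookup L i ≡ u
    lookup-0 (single _) {zero} _ = refl
    lookup-0 (cons _ _) {zero} _ = refl
  Trail-lookup-step (cons e t) {suc i} {suc j} eq = Trail-lookup-step t (ℕ.suc-injective eq)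

  Trail-lookup-last : Trail u L v → ∀ {i} → suc (toℕ i) ≡ length L → lookup L i ≡ v
  Trail-lookup-last (single _) {zero} _ = refl
  Trail-lookup-last (cons _ (single _)) {zero} ()
  Trail-lookup-last (cons _ (cons _ _)) {zero} ()
  Trail-lookup-last (cons _ t) {suc i} eq = Trail-lookup-last t (ℕ.suc-injective eq)

  -- The equation frees the length from the form `3 + m`, so that it can be a sum of path lengths.
  HasCycle : ℕ → Set
  HasCycle ℓ = ∃[ m ] (ℓ ≡ 3 + m × Cycle G m)

  Trail⇒HasCycle : Trail u L v → E v u → Unique L → 3 ≤ length L → HasCycle (length L)
  Trail⇒HasCycle {L = _ ∷ []} _ _ _ (s≤s ())
  Trail⇒HasCycle {L = _ ∷ _ ∷ []} _ _ _ (s≤s (s≤s ()))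
  Trail⇒HasCycle {L = L@(_ ∷ _ ∷ _ ∷ K)} t e uL _ = length K , refl , record
    { vtx = lookup L
    ; inj = Unique-lookup-injective uL
    ; closed = closed
    }
    where
    closed : ∀ i → E (lookup L i) (lookup L (next i))
    closed i with next-cases i
    ... | inj₁ eq = Trail-lookup-step t eq
    ... | inj₂ (eq₀ , eqₗ) with Fin.toℕ-injective {i = next i} {j = zero} eq₀
    ...   | eq₀′ rewrite eq₀′ = subst₂ E (sym (Trail-lookup-last t {i} eqₗ)) (Trail-head t) e

  -- The vertices of L form a trail from u to v in some order; leaving the order open lets
  -- reversed and rerouted paths keep the same vertex list.
  Path : V → V → List V → Set
  Path u v L = ∃[ K ] (K ↭ L × Trail u K v)

  Path-start∈ : Path u v L → u ∈ L
  Path-start∈ (_ , K↭L , t) = ∈-resp-↭ K↭L (Trail-start∈ t)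

  Path-end∈ : Path u v L → v ∈ L
  Path-end∈ (_ , K↭L , t) = ∈-resp-↭ K↭L (Trail-end∈ t)

  Path-single : ∀ v → Path v v [ v ]
  Path-single v = [ v ] , ↭-refl , single v

  Path-reverse : Path u v L → Path v u L
  Path-reverse (K , K↭L , t) = reverse K , ↭-trans (↭-reverse K) K↭L , Trail-reverse t

  Path-join : Path u v L → E v w → Path w z M → Path u z (L ++ M)
  Path-join (_ , K↭L , t) e (_ , K′↭M , s) = _ , ↭-++⁺ K↭L K′↭M , Trail-join t e s

  Path-resp-↭ : L ↭ M → Path u v L → Path u v M
  Path-resp-↭ L↭M (K , K↭L , t) = K , ↭-trans K↭L L↭M , t

  Path⇒HasCycle : Path u v L → E v u → Unique L → 3 ≤ length L → HasCycle (length L)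
  Path⇒HasCycle (_ , K↭L , t) e uL 3≤ = subst HasCycle (↭-length K↭L)
    (Trail⇒HasCycle t e (Unique-resp-↭ (↭-sym K↭L) uL) (subst (3 ≤_) (sym (↭-length K↭L)) 3≤))

  ∈⇒length≥1 : v ∈ L → 1 ≤ length L
  ∈⇒length≥1 {L = _ ∷ _} _ = s≤s z≤n

  ≢∈⇒length≥2 : u ∈ L → v ∈ L → u ≢ v → 2 ≤ length L
  ≢∈⇒length≥2 {L = _ ∷ []} (here refl) (here refl) u≢v = contradiction refl u≢v
  ≢∈⇒length≥2 {L = _ ∷ _ ∷ _} _ _ _ = s≤s (s≤s z≤n)

  -- Cycles in fans and in subdivisions of K₄.

  -- Three disjoint paths u ⋯ x, y ⋯ e, b ⋯ z with the edges xy, uy, eb, ub.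
  -- Adding uz makes it a fan of chords at u; adding xz makes it a subdivision of K₄
  -- with branch vertices u, x, y, b.
  record Frame (u x b z : V) (X Y Z : List V) : Set where
    field
      {y e} : V
      pathX : Path u x X
      pathY : Path y e Y
      pathZ : Path b z Z
      u≢x : u ≢ x
      uy : E u y
      xy : E x y
      eb : E e b
      ub : E u b
      unique : Unique (X ++ Y ++ Z)

  module _ {u x b z X Y Z} (F : Frame u x b z X Y Z) where
    open Frame F

    private
      uX : Unique X
      uX = proj₁ (Unique-++⁻ X unique)
      uYZ : Unique (Y ++ Z)
      uYZ = proj₁ (proj₂ (Unique-++⁻ X unique))
      uY : Unique Y
      uY = proj₁ (Unique-++⁻ Y uYZ)
      uZ : Unique Z
      uZ = proj₁ (proj₂ (Unique-++⁻ Y uYZ))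

      -- Every cycle below takes from each of X, Y, Z all vertices, some endpoints or nothing, so
      -- disjointness is inherited from the frame.
      cycle : ∀ A B C {s t} → Path s t (A ++ B ++ C) → E t s →
        Unique A → Unique B → Unique C → A ⊆ X → B ⊆ Y → C ⊆ Z →
        3 ≤ length A + (length B + length C) → HasCycle (length A + (length B + length C))
      cycle A B C p e uA uB uC A⊆X B⊆Y C⊆Z 3≤ = subst HasCycle length≡
        (Path⇒HasCycle p e (Unique-++⁺ uA (Unique-++⁺ uB uC B#C) A#BC) (subst (3 ≤_) (sym length≡) 3≤))
        where
        length≡ : length (A ++ B ++ C) ≡ length A + (length B + length C)
        length≡ = trans (length-++ A) (cong (length A +_) (length-++ B))
        B#C : Disjoint B C
        B#C (v∈B , v∈C) = proj₂ (proj₂ (Unique-++⁻ Y uYZ)) (B⊆Y v∈B , C⊆Z v∈C)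
        A#BC : Disjoint A (B ++ C)
        A#BC (v∈A , v∈BC) = proj₂ (proj₂ (Unique-++⁻ X unique)) (A⊆X v∈A ,
          Sum.[ ∈-++⁺ˡ ∘ B⊆Y , ∈-++⁺ʳ Y ∘ C⊆Z ]′ (∈-++⁻ B v∈BC))

      one : ∀ {v : V} → Unique [ v ]
      one = [] ∷ []

      sub : ∀ {v : V} {L} → v ∈ L → [ v ] ⊆ L
      sub v∈L (here refl) = v∈L

      none : ∀ {L : List V} → [] ⊆ L
      none ()

      u∈ = Path-start∈ pathX
      x∈ = Path-end∈ pathX
      y∈ = Path-start∈ pathY
      b∈ = Path-start∈ pathZ
      1≤Y = ∈⇒length≥1 y∈
      1≤Z = ∈⇒length≥1 b∈
      2≤X = ≢∈⇒length≥2 u∈ x∈ u≢x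

      cycle-Xy : HasCycle (length X + 1)
      cycle-Xy = cycle X [ y ] [] (Path-join pathX xy (Path-single y)) (E-sym uy)
        uX one [] id (sub y∈) none (ℕ.+-monoˡ-≤ 1 2≤X)

      cycle-XYb : HasCycle (length X + (length Y + 1))
      cycle-XYb = cycle X Y [ b ] (Path-join pathX xy (Path-join pathY eb (Path-single b))) (E-sym ub)
        uX uY one id id (sub b∈) (ℕ.+-mono-≤ 2≤X (ℕ.≤-trans 1≤Y (ℕ.m≤m+n _ 1)))

      cycle-uYb : HasCycle (1 + (length Y + 1))
      cycle-uYb = cycle [ u ] Y [ b ] (Path-join (Path-single u) uy (Path-join pathY eb (Path-single b))) (E-sym ub)
        one uY one (sub u∈) id (sub b∈) (s≤s (ℕ.+-monoˡ-≤ 1 1≤Y))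

    fan-cycles : E u z → b ≢ z → All HasCycle (fanLengths (length X) (length Y) (length Z))
    fan-cycles uz b≢z =
        cycle-Xy ∷ cycle-XYb ∷ cycle-uYb
      ∷ cycle X Y Z (Path-join pathX xy (Path-join pathY eb pathZ)) (E-sym uz)
          uX uY uZ id id id (ℕ.+-mono-≤ 2≤X (ℕ.≤-trans 1≤Y (ℕ.m≤m+n _ _)))
      ∷ cycle [ u ] Y Z (Path-join (Path-single u) uy (Path-join pathY eb pathZ)) (E-sym uz)
          one uY uZ (sub u∈) id id (s≤s (ℕ.+-mono-≤ 1≤Y 1≤Z))
      ∷ cycle [ u ] [] Z (Path-join (Path-single u) ub pathZ) (E-sym uz)
          one [] uZ (sub u∈) none id (s≤s (≢∈⇒length≥2 b∈ (Path-end∈ pathZ) b≢z))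
      ∷ []

    K₄-cycles : E x z → All HasCycle (K₄Lengths (length X) (length Y) (length Z))
    K₄-cycles xz =
        cycle-Xy ∷ cycle-XYb ∷ cycle-uYb
      ∷ cycle X Y Z (Path-resp-↭ (↭-++⁺ˡ X (++-comm Z Y))
            (Path-join pathX xz (Path-join (Path-reverse pathZ) (E-sym eb) (Path-reverse pathY)))) (E-sym uy)
          uX uY uZ id id id (ℕ.+-mono-≤ 2≤X (ℕ.≤-trans 1≤Y (ℕ.m≤m+n _ _)))
      ∷ cycle [ x ] Y Z (Path-join (Path-single x) xy (Path-join pathY eb pathZ)) (E-sym xz)
          one uY uZ (sub x∈) id id (s≤s (ℕ.+-mono-≤ 1≤Y 1≤Z))
      ∷ cycle X [] Z (Path-join pathX xz (Path-reverse pathZ)) (E-sym ub)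
          uX [] uZ id none id (ℕ.+-mono-≤ 2≤X 1≤Z)
      -- The cycle u, y, x, z ⋯ b; listing x next to u groups the vertices by the path they belong
      -- to.
      ∷ cycle (u ∷ x ∷ []) [ y ] Z (Path-resp-↭ (prep u (swap y x ↭-refl))
            (Path-join (Path-single u) uy (Path-join (Path-single y) (E-sym xy)
              (Path-join (Path-single x) xz (Path-reverse pathZ))))) (E-sym ub)
          ((u≢x ∷ []) ∷ one) one uZ (λ { (here refl) → u∈ ; (there (here refl)) → x∈ }) (sub y∈) id
          (s≤s (s≤s (s≤s z≤n)))
      ∷ []

  -- Finding frames along a path.

  open import Data.List.Membership.DecPropositional (Fin._≟_ {n}) using (_∈?_)

  escape? : ∀ v L → (∃[ w ] (E v w × w ∉ L)) ⊎ (∀ {w} → E v w → w ∈ L)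
  escape? v L with Fin.any? (λ w → E? v w ×-dec ¬? (w ∈? L))
  ... | yes p = inj₁ p
  ... | no ¬p = inj₂ λ {w} e → decidable-stable (w ∈? L) λ w∉L → ¬p (w , e , w∉L)

  -- The trail from y is cut just before b and again after z; the tail `D` beyond z is dropped.
  trails⇒Frame : ∀ {u x y b z w X} B {C} → Path u x X → u ≢ x → E u y → E x y → E u b →
    Trail y (y ∷ B ++ b ∷ C) w → z ∈ b ∷ C → Unique (X ++ y ∷ B ++ b ∷ C) →
    ∃[ Z ] Frame u x b z X (y ∷ B) Z
  trails⇒Frame {y = y} {b} {X = X} B pX u≢x uy xy ub t z∈ unq with Trail-split B t
  ... | e , tY , eb , t′ with Trail-prefix t′ z∈
  ...   | Z , D , eq , tZ = Z , record
    { pathX = pX ; pathY = _ , ↭-refl , tY ; pathZ = _ , ↭-refl , tZ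
    ; u≢x = u≢x ; uy = uy ; xy = xy ; eb = eb ; ub = ub
    ; unique = proj₁ (Unique-++⁻ (X ++ (y ∷ B) ++ Z) (subst Unique assoc unq))
    }
    where
    assoc : X ++ (y ∷ B) ++ b ∷ _ ≡ (X ++ (y ∷ B) ++ Z) ++ D
    assoc = trans (cong (λ K → X ++ (y ∷ B) ++ K) eq)
      (trans (cong (X ++_) (sym (++-assoc (y ∷ B) Z D))) (sym (++-assoc X ((y ∷ B) ++ Z) D)))

  HasFan HasK₄ : Set
  HasFan = ∃[ p ] ∃[ q ] ∃[ r ] All HasCycle (fanLengths p q r)
  HasK₄ = ∃[ p ] ∃[ q ] ∃[ r ] All HasCycle (K₄Lengths p q r)

  fan : ∀ {u x y b c w X} B {C} → Path u x X → u ≢ x → E u y → E x y → E u b → E u c →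
    Trail y (y ∷ B ++ b ∷ C) w → c ∈ C → Unique (X ++ y ∷ B ++ b ∷ C) → HasFan
  fan {X = X} B pX u≢x uy xy ub uc t c∈C unq with trails⇒Frame B pX u≢x uy xy ub t (there c∈C) unq
  ... | _ , F = _ , _ , _ , fan-cycles F uc b≢c
    where
    b≢c : _ ≢ _
    b≢c refl = Unique[x∷xs]⇒x∉xs (proj₁ (proj₂ (Unique-++⁻ (_ ∷ B) (proj₁ (proj₂ (Unique-++⁻ X unq)))))) c∈C

  -- The roles of (u, b) and (x, j) are interchangeable, so the frame can start from whichever
  -- of b and j comes first.
  K₄ : ∀ {u x y b j w X} B {C} → Path u x X → u ≢ x → E u y → E x y → E u b → E x j →
    Trail y (y ∷ B ++ b ∷ C) w → j ∈ B ++ b ∷ C → Unique (X ++ y ∷ B ++ b ∷ C) → HasK₄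
  K₄ B pX u≢x uy xy ub xj t j∈ unq with ∈-++⁻ B j∈
  ... | inj₂ j∈bC = _ , _ , _ , K₄-cycles (proj₂ (trails⇒Frame B pX u≢x uy xy ub t j∈bC unq)) xj
  K₄ {y = y} {b} {j} {X = X} B {C} pX u≢x uy xy ub xj t j∈ unq | inj₁ j∈B with ∈-∃++ j∈B
  ... | B₁ , B₂ , refl = _ , _ , _ , K₄-cycles (proj₂ (trails⇒Frame B₁ (Path-reverse pX) (u≢x ∘ sym) xy uy xj
    (subst (λ K → Trail y (y ∷ K) _) assoc t) (there (∈-++⁺ʳ B₂ (here refl)))
    (subst (λ K → Unique (X ++ y ∷ K)) assoc unq))) ub
    where
    assoc : (B₁ ++ j ∷ B₂) ++ b ∷ C ≡ B₁ ++ j ∷ B₂ ++ b ∷ C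
    assoc = ++-assoc B₁ (j ∷ B₂) (b ∷ C)

  -- Rotating a longest path when all degrees are at least 4.

  module _ (4≤degree : ∀ v → 4 ≤ degree G v) where

    private
      count : V → List V → ℕ
      count v L = length (filter (E? v) L)

      ∈-count : ∀ {v w L} → E v w → w ∈ L → w ∈ filter (E? v) L
      ∈-count {v} e w∈L = ∈-filter⁺ (E? v) w∈L e

      reverse-↭ : ∀ L {M : List V} → reverse L ++ M ↭ L ++ M
      reverse-↭ L = ↭-++⁺ʳ _ (↭-reverse L)

    -- The argument `longer` serves as induction hypothesis: a path on k vertices may be treated as
    -- longest, since any extension is passed to it.
    module _ {k} (longer : ∀ {u P w} → Trail u P w → Unique P → k < length P → HasFan × HasK₄) where

      -- L is an initial segment containing at least three neighbours of u.  If x has no neighbour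
      -- beyond y, then reversing u ⋯ x puts all neighbours of x other than y in a strictly shorter
      -- initial segment.
      rotate : ∀ f {u} L M {w} → Trail u (L ++ M) w → Unique (L ++ M) → length (L ++ M) ≡ k →
        length L ≤ f → 3 ≤ count u L → HasFan × HasK₄
      -- The chord uy bounds the segment u ⋯ x, of length at most `f`. After a rotation the next
      -- chord is sought inside this segment and bounds a shorter one, so `f` decreases.
      rotate-at : ∀ f {u} v A y R {w} → Trail u (u ∷ v ∷ A ++ y ∷ R) w → Unique (u ∷ v ∷ A ++ y ∷ R) →
        length (u ∷ v ∷ A ++ y ∷ R) ≡ k → length (u ∷ v ∷ A) ≤ f →
        E u y → All (¬_ ∘ E u) A → HasFan × HasK₄

      rotate f [] M t unq len L≤f ()
      rotate f {u} (v ∷ []) M t unq len L≤f 3≤ with E? u v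
      rotate f {u} (v ∷ []) M t unq len L≤f (s≤s ()) | yes _
      rotate f {u} (v ∷ []) M t unq len L≤f () | no _
      rotate (suc f) {u} (u′ ∷ v ∷ L) M t unq len (s≤s L≤f) 3≤ with Trail-head t
      -- Passing over u and v loses at most two of the three counted neighbours, so one is left in
      -- `L`.
      ... | refl with filter-first (E? u) L
        (s≤s⁻¹ (ℕ.≤-trans (s≤s⁻¹ (ℕ.≤-trans 3≤ (count-∷ u (v ∷ L)))) (count-∷ v L)))
        where
        count-∷ : ∀ z K → count u (z ∷ K) ≤ suc (count u K)
        count-∷ z K with E? u z
        ... | yes _ = ℕ.≤-refl
        ... | no _ = ℕ.n≤1+n _
      ...   | A , y , B , refl , uy , ¬A , _ = rotate-at f v A y (B ++ M)
        (subst (λ K → Trail u (u ∷ v ∷ K) _) (++-assoc A (y ∷ B) M) t)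
        (subst (λ K → Unique (u ∷ v ∷ K)) (++-assoc A (y ∷ B) M) unq)
        (trans (cong (λ K → length (u ∷ v ∷ K)) (sym (++-assoc A (y ∷ B) M))) len)
        (ℕ.≤-trans (s≤s (subst (suc (length A) ≤_) (sym (length-++ A))
          (subst (_≤ length A + suc (length B)) (ℕ.+-comm (length A) 1) (ℕ.+-monoʳ-≤ (length A) (s≤s z≤n))))) L≤f)
        uy ¬A

      rotate-at f {u} v A y R t unq len X≤f uy ¬A
        with escape? u (u ∷ v ∷ A ++ y ∷ R) | Trail-split (v ∷ A) t
      ... | inj₁ (w , uw , w∉) | _ =
        longer (cons (E-sym uw) t) (All.¬Any⇒All¬ _ w∉ ∷ unq) (s≤s (ℕ.≤-reflexive (sym len)))
      ... | inj₂ near | x , tX@(cons _ t₁) , xy , tR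
        with escape? x (u ∷ v ∷ A ++ y ∷ R) | Any.any? (E? x) R
      -- The rotated path x ⋯ u, y, ... has the same vertices, so a neighbour of x off the path
      -- prolongs it.
      ... | inj₁ (w , xw , w∉) | _ = longer
        (cons (E-sym xw) (Trail-join (Trail-reverse tX) uy tR))
        (All.¬Any⇒All¬ _ (w∉ ∘ ∈-resp-↭ (reverse-↭ (u ∷ v ∷ A))) ∷ Unique-resp-↭ (↭-sym (reverse-↭ (u ∷ v ∷ A))) unq)
        (s≤s (ℕ.≤-reflexive (sym (trans (↭-length (reverse-↭ (u ∷ v ∷ A))) len))))
      -- All neighbours of x except y lie in the segment u ⋯ x, hence at least three do.
      ... | inj₂ near-x | no ¬xR = rotate f (reverse (u ∷ v ∷ A)) (y ∷ R)
        (Trail-join (Trail-reverse tX) uy tR)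
        (Unique-resp-↭ (↭-sym (reverse-↭ (u ∷ v ∷ A))) unq)
        (trans (↭-length (reverse-↭ (u ∷ v ∷ A))) len)
        (subst (_≤ f) (sym (length-reverse (u ∷ v ∷ A))) X≤f)
        (s≤s⁻¹ (ℕ.≤-trans (4≤degree x) (degree-≤ {L = y ∷ filter (E? x) (reverse (u ∷ v ∷ A))} (λ e → locate e (near-x e)))))
        where
        locate : ∀ {w} → E x w → w ∈ (u ∷ v ∷ A) ++ y ∷ R → w ∈ y ∷ filter (E? x) (reverse (u ∷ v ∷ A))
        locate e w∈ with ∈-++⁻ (u ∷ v ∷ A) w∈
        ... | inj₁ w∈X = there (∈-count e (∈-resp-↭ (↭-sym (↭-reverse (u ∷ v ∷ A))) w∈X))
        ... | inj₂ (here refl) = here refl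
        ... | inj₂ (there w∈R) = contradiction (Any.map (λ { refl → e }) w∈R) ¬xR
      -- Of the at least four neighbours of u only v and y come before `R`, so `R` contains two
      -- more, b and c.
      ... | inj₂ near-x | yes xR with filter-first (E? u) R
        (s≤s⁻¹ (s≤s⁻¹ (ℕ.≤-trans (4≤degree u) (degree-≤ {L = v ∷ y ∷ filter (E? u) R} (λ e → locate e (near e))))))
        where
        locate : ∀ {w} → E u w → w ∈ u ∷ v ∷ A ++ y ∷ R → w ∈ v ∷ y ∷ filter (E? u) R
        locate e (here refl) = contradiction e E-irrefl
        locate e (there (here refl)) = here refl
        locate e (there (there w∈)) with ∈-++⁻ A w∈
        ... | inj₁ w∈A = contradiction e (All.lookup ¬A w∈A)
        ... | inj₂ (here refl) = there (here refl)
        ... | inj₂ (there w∈R) = there (there (∈-count e w∈R))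
      ... | B , b , C , refl , ub , _ , 1≤C with filter-first (E? u) C 1≤C | find xR
      ... | C₁ , c , C₂ , refl , uc , _ , _ | j , j∈R , xj =
          fan B pX u≢x uy xy ub uc tR (∈-++⁺ʳ C₁ (here refl)) unq
        , K₄ B pX u≢x uy xy ub xj tR j∈R unq
        where
        pX : Path u x (u ∷ v ∷ A)
        pX = _ , ↭-refl , tX
        u≢x : u ≢ x
        u≢x refl = Unique[x∷xs]⇒x∉xs unq (∈-++⁺ˡ (Trail-end∈ t₁))

    -- The bound `k` drops whenever the path grows and cannot reach 0, since no path has more than
    -- `n` vertices.
    longest-path-search : ∀ k {u P w} → Trail u P w → Unique P → n < length P + k → HasFan × HasK₄
    longest-path-search zero {P = P} t unq n< =
      contradiction (Unique⇒length≤n unq) (ℕ.<⇒≱ (subst (n <_) (ℕ.+-identityʳ (length P)) n<))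
    longest-path-search (suc k) {u} {P} t unq n< with escape? u P
    ... | inj₁ (w , uw , w∉) = longest-path-search k (cons (E-sym uw) t) (All.¬Any⇒All¬ _ w∉ ∷ unq)
      (subst (n <_) (ℕ.+-suc (length P) k) n<)
    ... | inj₂ near = rotate longer (length P) P []
      (subst (λ K → Trail u K _) (sym (++-identityʳ P)) t)
      (subst Unique (sym (++-identityʳ P)) unq)
      (cong length (++-identityʳ P)) ℕ.≤-refl
      (ℕ.≤-trans (ℕ.n≤1+n 3) (ℕ.≤-trans (4≤degree u) (degree-≤ λ e → ∈-count e (near e))))
      where
      longer : ∀ {u′ P′ w′} → Trail u′ P′ w′ → Unique P′ → length P < length P′ → HasFan × HasK₄
      longer {P′ = P′} t′ unq′ P<P′ = longest-path-search k t′ unq′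
        (ℕ.<-≤-trans n< (subst (_≤ length P′ + k) (sym (ℕ.+-suc (length P) k)) (ℕ.+-monoˡ-≤ k P<P′)))

    4≤degree⇒fan×K₄ : V → HasFan × HasK₄
    4≤degree⇒fan×K₄ v = longest-path-search n (single v) ([] ∷ []) ℕ.≤-refl

  -- Odd closed trails and bipartiteness.

  OddCycle : Set
  OddCycle = ∃[ m ] (Cycle G m × odd (3 + m) ≡ true)

  Trail-excise : ∀ A B {C} → Trail u (A ++ z ∷ B ++ z ∷ C) v →
    (∃[ x ] (Trail z (z ∷ B) x × E x z)) × Trail u (A ++ z ∷ C) v
  Trail-excise [] B t with Trail-head t
  ... | refl with Trail-split B t
  ...   | x , t₁ , e , t₂ = (x , t₁ , e) , t₂
  Trail-excise (_ ∷ []) B (cons e t) with Trail-excise [] B t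
  ... | inner , outer = inner , cons e outer
  Trail-excise (_ ∷ A@(_ ∷ _)) B (cons e t) with Trail-excise A B t
  ... | inner , outer = inner , cons e outer

  odd-closed-path⇒OddCycle : Trail u L v → E v u → Unique L → odd (length L) ≡ true → OddCycle
  odd-closed-path⇒OddCycle {L = _ ∷ []} (single _) e _ _ = contradiction e E-irrefl
  odd-closed-path⇒OddCycle {L = _ ∷ _ ∷ _ ∷ _} t e uL o with Trail⇒HasCycle t e uL (s≤s (s≤s (s≤s z≤n)))
  ... | _ , refl , C = _ , C , o

  -- Induction on the length: at a repeated vertex the trail splits into two shorter closed trails,
  -- one of them odd. Counting vertices of the list counts edges including the closing one.
  odd-closed-trail⇒OddCycle : ∀ k → length L ≤ k → Trail u L v → E v u → odd (length L) ≡ true → OddCycle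
  odd-closed-trail⇒OddCycle zero () (single _) e o
  odd-closed-trail⇒OddCycle zero () (cons _ _) e o
  odd-closed-trail⇒OddCycle {L = L} (suc k) L≤k t e o with duplicate? L
  ... | inj₁ uL = odd-closed-path⇒OddCycle t e uL o
  ... | inj₂ (A , z , B , C , refl)
    with Trail-excise A B t | odd (length (z ∷ B)) in o′
  ... | (_ , inner , e′) , _ | true = odd-closed-trail⇒OddCycle k
    (s≤s⁻¹ (ℕ.<-≤-trans (ℕ.m<m+n _ 0<outer) sum≤)) inner e′ o′
    where
    0<outer : 0 < length (A ++ z ∷ C)
    0<outer = subst (0 <_) (sym (trans (length-++ A) (ℕ.+-suc _ _))) (s≤s z≤n)
    sum≤ = subst (_≤ suc k) (length-excise A z B C) L≤k
  ... | _ , outer | false = odd-closed-trail⇒OddCycle k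
    (ℕ.≤-trans (ℕ.m≤n+m _ _) (s≤s⁻¹ (subst (_≤ suc k) (length-excise A z B C) L≤k))) outer e
    (trans (sym (trans (cong odd (length-excise A z B C)) (trans (odd-+ (length (z ∷ B)) _) (cong (_xor _) o′)))) o)

  Walk⇒Trail : Walk G u v → ∃[ L ] Trail u L v
  Walk⇒Trail [] = _ , single _
  Walk⇒Trail (e ∷ p) = _ , cons e (proj₂ (Walk⇒Trail p))

  -- Vertices are coloured by the parity of a chosen walk from r. An edge with equally coloured ends
  -- joins two such walks into an odd closed trail.
  Bipartite-or-OddCycle : Connected G → V → Bipartite G ⊎ OddCycle
  Bipartite-or-OddCycle connected r = decide
    where
    trail : ∀ v → ∃[ L ] Trail r L v
    trail v = Walk⇒Trail (connected r v)
    colour : V → Bool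
    colour v = odd (length (proj₁ (trail v)))

    close : ∀ {u v K L} → Trail r K u → Trail r L v → E u v → odd (length K) ≡ odd (length L) → OddCycle
    close t (single _) uv same = odd-closed-trail⇒OddCycle _ ℕ.≤-refl t uv same
    -- Leaving out the second copy of r flips the parity of one list, which makes the total odd.
    close {K = K} t (cons {L = L} e s) uv same = odd-closed-trail⇒OddCycle _ ℕ.≤-refl
      (Trail-join t uv (Trail-reverse s)) (E-sym e) parity
      where
      parity : odd (length (K ++ reverse L)) ≡ true
      parity rewrite length-++ K {reverse L} | length-reverse L | odd-+ (length K) (length L) | same =
        trans (sym (Bool.not-distribˡ-xor (odd (length L)) (odd (length L)))) (cong not (Bool.xor-same (odd (length L))))

    decide : Bipartite G ⊎ OddCycle
    decide with Fin.any? (λ u → Fin.any? (λ v → E? u v ×-dec (colour u Bool.≟ colour v)))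
    ... | no ¬mono = inj₁ (colour , λ u v uv same → ¬mono (u , v , uv , same))
    ... | yes (u , v , uv , same) = inj₂ (close (proj₂ (trail u)) (proj₂ (trail v)) uv same)

  -- Cycles in 2-regular graphs.

  module _ {m} (C : Cycle G m) where
    open Cycle C

    next-prev-distinct : ∀ j → vtx (next (next j)) ≢ vtx j
    next-prev-distinct j eq = next²-≢ j (inj eq)

    degree-2-neighbours : ∀ j → degree G (vtx (next j)) ≡ 2 → E (vtx (next j)) w →
      w ≡ vtx (next (next j)) ⊎ w ≡ vtx j
    degree-2-neighbours {w} j deg≡2 e with w Fin.≟ vtx (next (next j)) | w Fin.≟ vtx j
    ... | yes p | _ = inj₁ p
    ... | no _ | yes q = inj₂ q
    ... | no p | no q = contradiction
      (degree-≥ {L = w ∷ vtx (next (next j)) ∷ vtx j ∷ []} ((p ∷ q ∷ []) ∷ (next-prev-distinct j ∷ []) ∷ [] ∷ [])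
        (e ∷ closed (next j) ∷ E-sym (closed j) ∷ []))
      (subst (λ d → ¬ 3 ≤ d) (sym deg≡2) λ { (s≤s (s≤s ())) })

    -- Both neighbours of a cycle vertex are on the cycle, so no walk leaves it, and connectedness
    -- puts every vertex and edge on it.
    degree-2⇒OddCycleGraph : Connected G → (∀ v → degree G v ≡ 2) → odd (3 + m) ≡ true → OddCycleGraph G
    degree-2⇒OddCycleGraph connected deg≡2 o = m , C , odd⇒¬2∣ o , surjective , edges
      where
      neighbour : ∀ i → E (vtx i) w → ∃[ j ] ((i ≡ j × w ≡ vtx (next j)) ⊎ (w ≡ vtx j × i ≡ next j))
      neighbour i e with next-surjective i
      ... | j , refl with degree-2-neighbours j (deg≡2 _) e
      ...   | inj₁ eq = next j , inj₁ (refl , eq)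
      ...   | inj₂ eq = j , inj₂ (eq , refl)

      reach : Walk G u v → ∃[ i ] u ≡ vtx i → ∃[ i ] v ≡ vtx i
      reach [] p = p
      reach (e ∷ p) (i , refl) with neighbour i e
      ... | j , inj₁ (_ , eq) = reach p (next j , eq)
      ... | j , inj₂ (eq , _) = reach p (j , eq)

      on-cycle : ∀ v → ∃[ i ] v ≡ vtx i
      on-cycle v = reach (connected (vtx zero) v) (zero , refl)

      surjective : ∀ v → ∃[ i ] (∀ {j} → j ≡ i → vtx j ≡ v)
      surjective v with on-cycle v
      ... | i , eq = i , λ { refl → sym eq }

      edges : ∀ u v → E u v → ∃[ i ] ((u ≡ vtx i × v ≡ vtx (next i)) ⊎ (v ≡ vtx i × u ≡ vtx (next i)))
      edges u v uv with on-cycle u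
      ... | i , refl with neighbour i uv
      ...   | j , inj₁ (refl , eq) = j , inj₁ (refl , eq)
      ...   | j , inj₂ (eq , refl) = j , inj₂ (eq , refl)

  -- Every edge belongs to the cycle, so the neighbours of a vertex are its two distinct cycle
  -- neighbours.
  OddCycleGraph⇒Regular : OddCycleGraph G → Regular G
  OddCycleGraph⇒Regular (m , C , _ , surjective , edges) = 2 , degree≡2
    where
    open Cycle C

    neighbour : ∀ j → E (vtx (next j)) w → w ∈ vtx (next (next j)) ∷ vtx j ∷ []
    neighbour j e with edges _ _ e
    ... | i , inj₁ (p , q) rewrite inj p = here q
    ... | i , inj₂ (p , q) = there (here (trans p (cong vtx (next-injective (sym (inj q))))))

    degree≡2 : ∀ v → degree G v ≡ 2
    degree≡2 v with surjective v
    ... | i , onto with next-surjective i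
    ...   | j , refl with onto refl
    ...     | refl = ℕ.≤-antisym (degree-≤ (neighbour j))
      (degree-≥ ((next-prev-distinct C j ∷ []) ∷ [] ∷ []) (closed (next j) ∷ E-sym (closed j) ∷ []))

  -- Excluding odd cycles, and the equivalence.

  4≤degree⇒even-cycles : AtMostTwoCycleTypes G → (∀ v → 4 ≤ degree G v) → V → ∀ {m} → Cycle G m → 2 ∣ 3 + m
  4≤degree⇒even-cycles (a , b , types) 4≤degree v {m} C with 4≤degree⇒fan×K₄ 4≤degree v
  ... | (_ , _ , _ , fan) , (_ , _ , _ , K₄) = ∣n∣m%n⇒∣m {m = 3 + m} (divides 2 refl)
    (Sum.[ (λ eq → subst (2 ∣_) (sym eq) (proj₁ even)) , (λ eq → subst (2 ∣_) (sym eq) (proj₂ even)) ]′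
      (residue (m , refl , C)))
    where
    residue : ∀ {ℓ} → HasCycle ℓ → OfType (a mod 4) (b mod 4) ℓ
    residue (m , refl , C) = Sum.map reduce reduce (types m C)
      where
      -- The given types are arbitrary naturals; one that is attained is already below 4, so
      -- reduction preserves it.
      reduce : ∀ {c} → (3 + m) % 4 ≡ c → (3 + m) % 4 ≡ toℕ (c mod 4)
      reduce refl = trans (sym (m%n%n≡m%n (3 + m) 4)) (sym (Fin.toℕ-fromℕ< (m%n<n ((3 + m) % 4) 4)))
    even : 2 ∣ toℕ (a mod 4) × 2 ∣ toℕ (b mod 4)
    even = fan×K₄⇒even (All.map residue fan) (All.map residue K₄)

theorem28 : (G : Graph) → IsEuler G → AtMostTwoCycleTypes G →
    (Regular G ⇔ (OddCycleGraph G ⊎ (Regular G × Bipartite G × IsEuler G)))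
theorem28 G euler@(connected , (u , v , uv) , 2∣degree) types =
  mk⇔ forward Sum.[ OddCycleGraph⇒Regular , proj₁ ]′
  where
  open GraphTheory G

  odd-case : ∀ d → (∀ w → degree G w ≡ d) → OddCycle → OddCycleGraph G
  -- The edge uv rules out degree 0, and even degrees rule out 1 and 3.
  odd-case 0 deg≡ _ = contradiction
    (subst (1 ≤_) (deg≡ u) (degree-≥ {L = [ v ]} ([] ∷ []) (uv ∷ []))) λ ()
  odd-case 1 deg≡ _ = contradiction (subst (2 ∣_) (deg≡ u) (2∣degree u)) (from-no (2 ∣? 1))
  odd-case 2 deg≡ (_ , C , o) = degree-2⇒OddCycleGraph C connected deg≡ o
  odd-case 3 deg≡ _ = contradiction (subst (2 ∣_) (deg≡ u) (2∣degree u)) (from-no (2 ∣? 3))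
  odd-case (suc (suc (suc (suc d)))) deg≡ (_ , C , o) = contradiction
    (4≤degree⇒even-cycles types (λ w → subst (4 ≤_) (sym (deg≡ w)) (ℕ.m≤m+n 4 d)) u C) (odd⇒¬2∣ o)

  forward : Regular G → OddCycleGraph G ⊎ (Regular G × Bipartite G × IsEuler G)
  forward regular@(d , deg≡) with Bipartite-or-OddCycle connected u
  ... | inj₁ bipartite = inj₂ (regular , bipartite , euler)
  ... | inj₂ oddCycle = inj₁ (odd-case d deg≡ oddCycle)
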